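{- Let $M$ be a relational Fraïssé structure with strong amalgamation. Then the following are equivalent: (i) $M$ has the canonical infinite point-Ramsey property; (ii) $M$ has the galah property; (iii) $M$ is locally replicable.
   Context: A Fraïssé structure is a countably infinite ultrahomogeneous first-order structure; it is relational if its language is relational. The age $\mathrm{Age}(M)$ is the class of finite structures embeddable in $M$. $M$ has strong amalgamation if for all pairs of embeddings $B_0 \leftarrow A \rightarrow B_1$ in $\mathrm{Age}(M)$ there is an amalgam $B_0 \rightarrow C \leftarrow B_1$ in $\mathrm{Age}(M)$ such that the images of $B_0$ and $B_1$ in $C$ intersect exactly in the image of $A$. A copy of $M$ in a set or structure is an induced substructure isomorphic to $M$; subsets of $M$ are regarded as induced substructures. $M$ has the canonical infinite point-Ramsey property if for each colouring $\chi : M \to \omega$ there is a copy of $M$ in $M$ which is monochromatic (all elements have the same colour) or heterochromatic (all elements have pairwise different colours). $M$ has the galah property if for each partition $(C, D)$ of the domain of $M$ into two parts, $C \cong M$ or $D$ contains a copy of $M$. Topology on $M$: for each finite substructure $A$ of $M$ (possibly empty) and each $b \in M \setminus A$, the set $\{v \in M \mid \mathrm{qftp}(v/A) = \mathrm{qftp}(b/A)\}$ is a basic open set, where $\mathrm{qftp}(v/A)$ is the quantifier-free type of $v$ over $A$. $M$ is locally replicable if every non-empty open set in $M$ contains a copy of $M$. -}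

module Defs where

open import Level using (Level; suc)
open import Data.Empty.Polymorphic using (⊥)
open import Data.Fin.Base using (Fin)
open import Data.Maybe.Base using (Maybe; maybe)
open import Data.Nat.Base using (ℕ)
open import Data.Product.Base using (_×_; Σ-syntax; ∃-syntax)
open import Data.Refinement using (Refinement; value)
open import Data.Sum.Base using (_⊎_)
open import Data.Vec.Base using (Vec; map)
open import Function.Base using (_∘_)
open import Function.Bundles using (_⇔_; _↔_; Inverse)
open import Function.Definitions using (Injective)
open import Relation.Binary.PropositionalEquality.Core using (_≡_; _≢_)
open import Relation.Nullary.Negation.Core using (¬_)
open import Relation.Unary using (Pred; _∈_; _∉_; _⊆_; _≐_; _∩_; _∪_; Empty; Universal; Satisfiable)

private
  variable
    ℓ : Level

-- One universe Set ℓ plays the role of the universe of sets: symbols, elements,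
-- truth values and subsets all live there.

record Language (ℓ : Level) : Set (suc ℓ) where
  field
    Symbol : Set ℓ
    arity  : Symbol → ℕ

open Language public

record Structure (L : Language ℓ) : Set (suc ℓ) where
  field
    Carrier : Set ℓ
    Rel     : (R : Symbol L) → Vec Carrier (arity L R) → Set ℓ

open Structure public

module _ {L : Language ℓ} where

  PreservesRelations : (M N : Structure L) → (Carrier M → Carrier N) → Set ℓ
  PreservesRelations M N f = ∀ R xs → Rel M R xs ⇔ Rel N R (map f xs)

  record Embedding (M N : Structure L) : Set ℓ where
    field
      to        : Carrier M → Carrier N
      injective : Injective _≡_ _≡_ to
      preserves : PreservesRelations M N to

  infix 4 _≅_
  record _≅_ (M N : Structure L) : Set ℓ where
    field
      bijection : Carrier M ↔ Carrier N
      preserves : PreservesRelations M N (Inverse.to bijection)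

    to : Carrier M → Carrier N
    to = Inverse.to bijection

  -- The membership proofs in a Refinement are irrelevant, so an element of the
  -- induced substructure is determined by the underlying element of M.
  Induced : (M : Structure L) → Pred (Carrier M) ℓ → Structure L
  Induced M A = record
    { Carrier = Refinement (Carrier M) A
    ; Rel     = λ R xs → Rel M R (map value xs)
    }

  Finite : Structure L → Set ℓ
  Finite A = ∃[ n ] (Fin n ↔ Carrier A)

  CountablyInfinite : Structure L → Set ℓ
  CountablyInfinite M = ℕ ↔ Carrier M

  Ultrahomogeneous : Structure L → Set (suc ℓ)
  Ultrahomogeneous M =
    ∀ (A B : Pred (Carrier M) ℓ) →
    Finite (Induced M A) → Finite (Induced M B) →
    (f : Induced M A ≅ Induced M B) →
    ∃[ α ] (∀ a → _≅_.to {M} {M} α (value a) ≡ value (_≅_.to f a))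

  IsFraisse : Structure L → Set (suc ℓ)
  IsFraisse M = CountablyInfinite M × Ultrahomogeneous M

  Age : Structure L → Pred (Structure L) ℓ
  Age M A = Finite A × Embedding A M

  Image : {X Y : Set ℓ} → (X → Y) → Pred Y ℓ
  Image f y = ∃[ x ] f x ≡ y

  StrongAmalgamation : Structure L → Set (suc ℓ)
  StrongAmalgamation M =
    ∀ (A B₀ B₁ : Structure L) → A ∈ Age M → B₀ ∈ Age M → B₁ ∈ Age M →
    (f₀ : Embedding A B₀) (f₁ : Embedding A B₁) →
    Σ[ C ∈ Structure L ] C ∈ Age M ×
    Σ[ g₀ ∈ Embedding B₀ C ] Σ[ g₁ ∈ Embedding B₁ C ]
      (∀ a → to g₀ (to f₀ a) ≡ to g₁ (to f₁ a)) ×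
      (Image (to g₀) ∩ Image (to g₁)) ≐ Image (to g₀ ∘ to f₀)
    where open Embedding

  IsCopy : (M : Structure L) → Pred (Carrier M) ℓ → Set ℓ
  IsCopy M N = Induced M N ≅ M

  ContainsCopy : (M : Structure L) → Pred (Carrier M) ℓ → Set (suc ℓ)
  ContainsCopy M C = ∃[ N ] IsCopy M N × N ⊆ C

  Monochromatic Heterochromatic :
    (M : Structure L) → (Carrier M → ℕ) → Pred (Carrier M) ℓ → Set ℓ
  Monochromatic   M χ N = ∀ {x y} → x ∈ N → y ∈ N → χ x ≡ χ y
  Heterochromatic M χ N = ∀ {x y} → x ∈ N → y ∈ N → x ≢ y → χ x ≢ χ y

  CanonicalPointRamsey : Structure L → Set (suc ℓ)
  CanonicalPointRamsey M =
    ∀ (χ : Carrier M → ℕ) →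
    ∃[ N ] IsCopy M N × (Monochromatic M χ N ⊎ Heterochromatic M χ N)

  Galah : Structure L → Set (suc ℓ)
  Galah M =
    ∀ (C D : Pred (Carrier M) ℓ) → Universal (C ∪ D) → Empty (C ∩ D) →
    Induced M C ≅ M ⊎ ContainsCopy M D

-- Quantifier-free formulas with variables in V.
data QF (L : Language ℓ) (V : Set ℓ) : Set ℓ where
  _≈′_      : V → V → QF L V
  rel       : (R : Symbol L) → Vec V (arity L R) → QF L V
  ⊥′        : QF L V
  ¬′_       : QF L V → QF L V
  _∧′_ _∨′_ : QF L V → QF L V → QF L V

module _ {L : Language ℓ} (M : Structure L) where

  infix 4 _⊨_
  _⊨_ : {V : Set ℓ} → (V → Carrier M) → QF L V → Set ℓ
  ρ ⊨ (x ≈′ y)  = ρ x ≡ ρ y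
  ρ ⊨ rel R xs  = Rel M R (map ρ xs)
  ρ ⊨ ⊥′        = ⊥
  ρ ⊨ (¬′ φ)    = ¬ (ρ ⊨ φ)
  ρ ⊨ (φ ∧′ ψ)  = (ρ ⊨ φ) × (ρ ⊨ ψ)
  ρ ⊨ (φ ∨′ ψ)  = (ρ ⊨ φ) ⊎ (ρ ⊨ ψ)

  -- qftp A v is the set of quantifier-free formulas in one free variable
  -- (nothing) with parameters from A (just a) that v satisfies.
  qftp : (A : Pred (Carrier M) ℓ) → Carrier M → Pred (QF L (Maybe (Refinement (Carrier M) A))) ℓ
  qftp A v φ = maybe value v ⊨ φ

  BasicOpen : Pred (Pred (Carrier M) ℓ) (suc ℓ)
  BasicOpen U =
    ∃[ A ] Finite (Induced M A) ×
    ∃[ b ] b ∉ A × U ≐ (λ v → qftp A v ≐ qftp A b)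

  -- The basic open sets form a base: if v lies in the ones given by A and A′,
  -- then v ∉ A ∪ A′ and the one given by A ∪ A′ and v is contained in both.
  Open : Pred (Pred (Carrier M) ℓ) (suc ℓ)
  Open U = ∀ {x} → x ∈ U → ∃[ B ] BasicOpen B × x ∈ B × B ⊆ U

  LocallyReplicable : Set (suc ℓ)
  LocallyReplicable = ∀ U → Open U → Satisfiable U → ContainsCopy M U

{-# OPTIONS --safe #-}
-- By ultrahomogeneity every open set is a union of orbits Orbit as b = {γ b | γ fixes as}, so local
-- replicability says that each of these with b ∉ as hosts an embedding of M.
-- Galah ⇒ locally replicable: the complement of an orbit omits a type over as, so it is not a copy.
-- Locally replicable ⇒ Galah: if D contains no orbit, then C realises every type over each finite
-- part of C, and back-and-forth gives C ≅ M.
-- Galah ⇒ canonical: if every orbit carries unboundedly many colours, a copy with increasing colours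
-- is built greedily; otherwise M embeds into an orbit with finitely many colours, which Galah removes
-- one at a time.
-- Canonical ⇒ locally replicable: enumerate the tuples t of the type of as and colour v by the first
-- t over which v realises the type of b. A monochromatic copy lies over a single t. A heterochromatic
-- copy contains some t, over which only finitely many colours occur, whereas by strong amalgamation
-- infinitely many of its elements realise the type of b over t.
module Submission where

open import Defs
open import Level using (Level; Lift; lift; lower)
open import Axiom.ExcludedMiddle using (ExcludedMiddle)
open import Data.Product.Base using (_×_; Σ-syntax; ∃-syntax; _,_; proj₁; proj₂)
open import Function.Bundles using (_⇔_; _↔_; mk⇔; mk↔ₛ′; Inverse; Equivalence)
open import Data.Fin.Base using (Fin) renaming (zero to fzero; suc to fsuc)
open import Data.Empty using (⊥-elim)
open import Data.Irrelevant using ([_])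
open import Data.List.Base as List using (List; []; _∷_; _++_; length; lookup; deduplicate; allFin;
  applyDownFrom)
open import Data.List.Extrema.Nat using (max; xs≤max)
open import Data.List.Membership.Propositional using () renaming (_∈_ to _∈ₗ_; _∉_ to _∉ₗ_)
open import Data.List.Membership.Propositional.Properties
  using (∈-map⁺; ∈-map⁻; ∈-lookup; ∈-++⁺ˡ; ∈-++⁺ʳ; ∈-allFin;
    ∈-deduplicate⁺; ∈-deduplicate⁻; ∈-applyDownFrom⁺; ∈-applyDownFrom⁻)
open import Data.List.Properties as Listₚ using ()
open import Data.List.Relation.Unary.All as All using (All; []; _∷_)
open import Data.List.Relation.Unary.AllPairs using ([]; _∷_)
open import Data.List.Relation.Unary.Any using (here; there; index)
open import Data.List.Relation.Unary.Any.Properties using (lookup-index)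
open import Data.List.Relation.Unary.Unique.Propositional using (Unique)
import Data.List.Relation.Unary.Unique.DecPropositional.Properties as UniqueDec
open import Data.Maybe.Base using (Maybe; just; nothing; maybe)
open import Data.Nat.Base using (ℕ; zero; suc; _*_; _≤_; _<_; z≤n; s≤s; _≤′_; ≤′-reflexive; ≤′-step; _⊔_)
import Data.Nat.Properties as ℕ
open import Data.Refinement using (Refinement; value; _,_; value-injective)
open import Data.Sum.Base as Sum using (_⊎_; inj₁; inj₂; swap)
open import Data.Vec.Base as Vec using (Vec; map; []; _∷_)
open import Data.Vec.Properties using (map-∘; map-id; map-cong)
open import Data.Vec.Relation.Unary.All as VecAll using () renaming (All to VecAll; [] to []ᵛ; _∷_ to _∷ᵛ_)
open import Function.Base using (_∘_; id)
open import Function.Construct.Composition using () renaming (equivalence to ⇔-trans)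
open import Function.Construct.Symmetry using (⇔-sym)
open import Function.Properties.Inverse using (↔-sym; ↔-trans; ↔-refl)
open import Relation.Binary.Definitions using (DecidableEquality; tri<; tri≈; tri>)
open import Relation.Binary.PropositionalEquality
  using (_≡_; _≢_; refl; sym; trans; cong; cong₂; subst)
open import Relation.Nullary using (¬_; yes; no; contradiction)
open import Relation.Nullary.Decidable using (Dec; recompute; decidable-stable; toSum)
open import Relation.Unary using (Pred; _∈_; _∉_; _⊆_; _≐_; Satisfiable)

private
  variable
    ℓ ℓ′ : Level
    L : Language ℓ

-- Lists and vectors.

lookup-injective : {X : Set ℓ} {xs : List X} → Unique xs →
  ∀ {i j} → lookup xs i ≡ lookup xs j → i ≡ j
lookup-injective (x∉ ∷ u) {fzero}  {fzero}  eq = refl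
lookup-injective (x∉ ∷ u) {fzero}  {fsuc j} eq = contradiction eq (All.lookup x∉ (∈-lookup j))
lookup-injective (x∉ ∷ u) {fsuc i} {fzero}  eq = contradiction (sym eq) (All.lookup x∉ (∈-lookup i))
lookup-injective (x∉ ∷ u) {fsuc i} {fsuc j} eq = cong fsuc (lookup-injective u eq)

map-cong-All : {X : Set ℓ} {Y : Set ℓ′} {f g : X → Y} {n : ℕ} {xs : Vec X n} →
  VecAll (λ x → f x ≡ g x) xs → map f xs ≡ map g xs
map-cong-All []ᵛ       = refl
map-cong-All (p ∷ᵛ ps) = cong₂ _∷_ p (map-cong-All ps)

-- Isomorphisms and embeddings of structures.

open Embedding using (injective) renaming (to to emb; preserves to emb-preserves)
open _≅_ using () renaming (preserves to iso-preserves)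

infixr 6 _·_
_·_ : {S T : Structure L} → S ≅ T → Carrier S → Carrier T
α · x = Inverse.to (_≅_.bijection α) x

rel-resp : (S : Structure L) (R : Symbol L) {xs ys : Vec (Carrier S) (arity L R)} →
  xs ≡ ys → Rel S R xs ⇔ Rel S R ys
rel-resp S R refl = mk⇔ id id

module _ {L : Language ℓ} where

  ≅-refl : {S : Structure L} → S ≅ S
  ≅-refl {S} = record
    { bijection = ↔-refl
    ; preserves = λ R xs → rel-resp S R (sym (map-id xs))
    }

  infix 8 _⁻¹
  _⁻¹ : {S T : Structure L} → S ≅ T → T ≅ S
  _⁻¹ {S} {T} α = record
    { bijection = ↔-sym b
    ; preserves = λ R xs → ⇔-sym (⇔-trans (iso-preserves α R (map (Inverse.from b) xs))
        (rel-resp T R (trans (sym (map-∘ _ _ xs))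
          (trans (map-cong (Inverse.strictlyInverseˡ b) xs) (map-id xs)))))
    }
    where b = _≅_.bijection α

  infixr 7 _⨾_
  _⨾_ : {S T U : Structure L} → S ≅ T → T ≅ U → S ≅ U
  _⨾_ {S} {T} {U} α β = record
    { bijection = ↔-trans (_≅_.bijection α) (_≅_.bijection β)
    ; preserves = λ R xs → ⇔-trans (iso-preserves α R xs)
        (⇔-trans (iso-preserves β R (map (α ·_) xs)) (rel-resp U R (sym (map-∘ _ _ xs))))
    }

  inverseʳ : {S T : Structure L} (α : S ≅ T) (y : Carrier T) → α · α ⁻¹ · y ≡ y
  inverseʳ α = Inverse.strictlyInverseˡ (_≅_.bijection α)

  inverseˡ : {S T : Structure L} (α : S ≅ T) (x : Carrier S) → α ⁻¹ · α · x ≡ x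
  inverseˡ α = Inverse.strictlyInverseʳ (_≅_.bijection α)

  inverse-unique : {S T : Structure L} (α : S ≅ T) {x : Carrier S} {y : Carrier T} →
    α · x ≡ y → α ⁻¹ · y ≡ x
  inverse-unique α {x} eq = trans (cong (α ⁻¹ ·_) (sym eq)) (inverseˡ α x)

  ·-injective : {S T : Structure L} (α : S ≅ T) {x y : Carrier S} → α · x ≡ α · y → x ≡ y
  ·-injective α {x} {y} eq = trans (sym (inverse-unique α eq)) (inverseˡ α y)

  ≅⇒embedding : {S T : Structure L} → S ≅ T → Embedding S T
  ≅⇒embedding α = record
    { to        = α ·_
    ; injective = ·-injective α
    ; preserves = iso-preserves α
    }

  infixr 7 _⨾ₑ_
  _⨾ₑ_ : {S T U : Structure L} → Embedding S T → Embedding T U → Embedding S U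
  _⨾ₑ_ {S} {T} {U} e f = record
    { to        = emb f ∘ emb e
    ; injective = injective e ∘ injective f
    ; preserves = λ R xs → ⇔-trans (emb-preserves e R xs)
        (⇔-trans (emb-preserves f R (map (emb e) xs)) (rel-resp U R (sym (map-∘ _ _ xs))))
    }

  surjective⇒≅ : {S T : Structure L} (e : Embedding S T) → (∀ y → ∃[ x ] emb e x ≡ y) → S ≅ T
  surjective⇒≅ e surj = record
    { bijection = mk↔ₛ′ (emb e) (proj₁ ∘ surj) (proj₂ ∘ surj)
        (λ x → injective e (proj₂ (surj (emb e x))))
    ; preserves = emb-preserves e
    }

  inclusion : (S : Structure L) (A : Pred (Carrier S) ℓ) → Embedding (Induced S A) S
  inclusion S A = record
    { to        = value
    ; injective = value-injective
    ; preserves = λ R xs → mk⇔ id id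
    }

  induced-mono : (S : Structure L) {A B : Pred (Carrier S) ℓ} → A ⊆ B →
    Embedding (Induced S A) (Induced S B)
  induced-mono S {A} {B} A⊆B = record
    { to        = widen
    ; injective = λ eq → value-injective (cong value eq)
    ; preserves = λ R xs → rel-resp S R (map-∘ value widen xs)
    }
    where
    widen : Refinement (Carrier S) A → Refinement (Carrier S) B
    widen (x , [ p ]) = x , [ A⊆B p ]

  onto-image : {S T : Structure L} (e : Embedding S T) → Embedding S (Induced T (Image {L = L} (emb e)))
  onto-image {S} {T} e = record
    { to        = corestrict
    ; injective = injective e ∘ cong value
    ; preserves = λ R xs → ⇔-trans (emb-preserves e R xs) (rel-resp T R (map-∘ value corestrict xs))
    }
    where
    corestrict : Carrier S → Refinement (Carrier T) (Image {L = L} (emb e))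
    corestrict x = emb e x , [ x , refl ]

  -- Injectivity and preservation of a relation each involve only finitely many points, so agreement
  -- with some embedding on every finite tuple suffices. This makes pointwise limits of
  -- automorphisms embeddings.
  locally-embedding : {S T : Structure L} (f : Carrier S → Carrier T) →
    (∀ {n} (xs : Vec (Carrier S) n) → Σ[ h ∈ Embedding S T ] VecAll (λ x → emb h x ≡ f x) xs) →
    Embedding S T
  locally-embedding {S} {T} f loc = record
    { to        = f
    ; injective = inj
    ; preserves = λ R xs → let h , eqs = loc xs in
        ⇔-trans (emb-preserves h R xs) (rel-resp T R (map-cong-All eqs))
    }
    where
    inj : ∀ {x y} → f x ≡ f y → x ≡ y
    inj {x} {y} eq with h , p ∷ᵛ q ∷ᵛ []ᵛ ← loc (x ∷ y ∷ []) =
      injective h (trans p (trans eq (sym q)))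

  -- Induction on the formula. Both directions are needed at once because negation exchanges them;
  -- injectivity handles equality.
  ⊨-embedding : {S T : Structure L} {V : Set ℓ} {ρ : V → Carrier S} {σ : V → Carrier T}
    (e : Embedding S T) → (∀ x → emb e (ρ x) ≡ σ x) → ∀ φ → _⊨_ S ρ φ ⇔ _⊨_ T σ φ
  ⊨-embedding e eqs (x ≈′ y) = mk⇔
    (λ p → trans (sym (eqs x)) (trans (cong (emb e) p) (eqs y)))
    (λ p → injective e (trans (eqs x) (trans p (sym (eqs y)))))
  ⊨-embedding {T = T} e eqs (rel R xs) = ⇔-trans (emb-preserves e R _)
    (rel-resp T R (trans (sym (map-∘ _ _ xs)) (map-cong eqs xs)))
  ⊨-embedding e eqs ⊥′ = mk⇔ (λ ()) (λ ())
  ⊨-embedding e eqs (¬′ φ) = let ih = ⊨-embedding e eqs φ in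
    mk⇔ (_∘ Equivalence.from ih) (_∘ Equivalence.to ih)
  ⊨-embedding e eqs (φ ∧′ ψ) = let p = ⊨-embedding e eqs φ ; q = ⊨-embedding e eqs ψ in
    mk⇔ (λ (a , b) → Equivalence.to p a , Equivalence.to q b)
        (λ (a , b) → Equivalence.from p a , Equivalence.from q b)
  ⊨-embedding e eqs (φ ∨′ ψ) = let p = ⊨-embedding e eqs φ ; q = ⊨-embedding e eqs ψ in
    mk⇔ (λ { (inj₁ a) → inj₁ (Equivalence.to p a) ; (inj₂ b) → inj₂ (Equivalence.to q b) })
        (λ { (inj₁ a) → inj₁ (Equivalence.from p a) ; (inj₂ b) → inj₂ (Equivalence.from q b) })

-- Lists and the coding of tuples of numbers.

map-≡⇒≡ : {X : Set ℓ} {Y : Set ℓ′} {f g : X → Y} {xs : List X} →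
  List.map f xs ≡ List.map g xs → ∀ {x} → x ∈ₗ xs → f x ≡ g x
map-≡⇒≡ eq (here refl) = Listₚ.∷-injectiveˡ eq
map-≡⇒≡ eq (there x∈)  = map-≡⇒≡ (Listₚ.∷-injectiveʳ eq) x∈

map-cong-∈ : {X : Set ℓ} {Y : Set ℓ′} {f g : X → Y} {xs : List X} →
  (∀ {x} → x ∈ₗ xs → f x ≡ g x) → List.map f xs ≡ List.map g xs
map-cong-∈ eq = Listₚ.map-cong-local (All.tabulate eq)

-- The value is 2^x (2y + 1), so x can be recovered as the exponent of 2.
pair : ℕ → ℕ → ℕ
pair zero    y = suc (2 * y)
pair (suc x) y = 2 * pair x y

pair-injective : ∀ x x′ {y y′} → pair x y ≡ pair x′ y′ → x ≡ x′ × y ≡ y′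
pair-injective zero    zero     eq = refl , ℕ.*-cancelˡ-≡ _ _ 2 (ℕ.suc-injective eq)
pair-injective zero    (suc x′) {y} {y′} eq = contradiction (sym eq) (ℕ.even≢odd (pair x′ y′) y)
pair-injective (suc x) zero     {y} {y′} eq = contradiction eq (ℕ.even≢odd (pair x y) y′)
pair-injective (suc x) (suc x′) eq
  with refl , y≡y′ ← pair-injective x x′ (ℕ.*-cancelˡ-≡ _ _ 2 eq) = refl , y≡y′

code : List ℕ → ℕ
code []       = zero
code (x ∷ xs) = suc (pair x (code xs))

code-injective : ∀ xs ys → code xs ≡ code ys → xs ≡ ys
code-injective []       []       eq = refl
code-injective (x ∷ xs) (y ∷ ys) eq
  with refl , eq′ ← pair-injective x y (ℕ.suc-injective eq) = cong (x ∷_) (code-injective xs ys eq′)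

iterate : {X : Set ℓ} → (ℕ → X → X) → X → ℕ → X
iterate step x zero    = x
iterate step x (suc n) = step n (iterate step x n)

-- Finiteness and least numbers under excluded middle.

module Classical {ℓ : Level} (em : ExcludedMiddle ℓ) {L : Language ℓ} where

  -- The stored membership proof is irrelevant; deciding `A` by excluded middle allows it to be
  -- recomputed in relevant form.
  member : {X : Set ℓ} {A : Pred X ℓ} (z : Refinement X A) → value z ∈ A
  member (x , [ p ]) = recompute em p

  ≅-image : {S T : Structure L} (e : Embedding S T) → S ≅ Induced T (Image {L = L} (emb e))
  ≅-image e = surjective⇒≅ (onto-image e)
    λ z → proj₁ (member z) , value-injective (proj₂ (member z))

  least-or-none-below : (P : ℕ → Set ℓ) (n : ℕ) →
    (∃[ m ] P m × (∀ {k} → P k → m ≤ k)) ⊎ (∀ {k} → P k → n ≤ k)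
  least-or-none-below P zero    = inj₂ (λ _ → z≤n)
  least-or-none-below P (suc n) with least-or-none-below P n
  ... | inj₁ found = inj₁ found
  ... | inj₂ n≤ with em {P n}
  ...   | yes p = inj₁ (n , p , n≤)
  ...   | no ¬p = inj₂ λ q → ℕ.≤∧≢⇒< (n≤ q) λ { refl → ¬p q }

  least : {P : ℕ → Set ℓ} {n : ℕ} → P n → ∃[ m ] P m × (∀ {k} → P k → m ≤ k)
  least {P} {n} p with least-or-none-below P (suc n)
  ... | inj₁ found = found
  ... | inj₂ n<    = contradiction (n< p) (ℕ.<-irrefl refl)

  -- Induction on the bound: raising it from `n` to `suc n` admits at most one more element, since
  -- `c` takes the value `n` at most once on `P`.
  injective-bounded⇒finite : {X : Set ℓ} (P : Pred X ℓ) (c : X → ℕ) →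
    (∀ {x y} → x ∈ P → y ∈ P → c x ≡ c y → x ≡ y) →
    ∀ n → ∃[ xs ] (∀ {x} → x ∈ P → c x < n → x ∈ₗ xs)
  injective-bounded⇒finite P c inj zero    = [] , λ _ ()
  injective-bounded⇒finite P c inj (suc n)
    with xs , complete ← injective-bounded⇒finite P c inj n
    with em {∃[ x ] x ∈ P × c x ≡ n}
  ... | yes (y , y∈ , refl) = y ∷ xs , λ x∈ cx< → case-< x∈ (ℕ.m<1+n⇒m<n∨m≡n cx<)
    where
    case-< : ∀ {x} → x ∈ P → c x < n ⊎ c x ≡ n → x ∈ₗ y ∷ xs
    case-< x∈ (inj₁ cx<) = there (complete x∈ cx<)
    case-< x∈ (inj₂ eq)  = here (inj x∈ y∈ eq)
  ... | no ¬∃ = xs , λ x∈ cx< →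
    complete x∈ (ℕ.≤∧≢⇒< (ℕ.≤-pred cx<) λ eq → ¬∃ (_ , x∈ , eq))

  finite-≅ : {S T : Structure L} → S ≅ T → Finite S → Finite T
  finite-≅ α (n , b) = n , ↔-trans b (_≅_.bijection α)

  finite-list : (S : Structure L) (xs : List (Carrier S)) → Finite (Induced S (_∈ₗ xs))
  finite-list S xs = length ys , mk↔ₛ′
    at
    (index ∘ ys-complete)
    (λ z → value-injective (sym (lookup-index (ys-complete z))))
    (λ i → lookup-injective (UniqueDec.deduplicate-! _≟_ xs) (sym (lookup-index (ys-complete (at i)))))
    where
    _≟_ : DecidableEquality (Carrier S)
    x ≟ y = em
    ys = deduplicate _≟_ xs
    at : Fin (length ys) → Refinement (Carrier S) (_∈ₗ xs)
    at i = lookup ys i , [ ∈-deduplicate⁻ _≟_ xs (∈-lookup i) ]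
    ys-complete : (z : Refinement (Carrier S) (_∈ₗ xs)) → value z ∈ₗ ys
    ys-complete z = ∈-deduplicate⁺ _≟_ (member z)

  -- Homogeneity and orbits of pointwise stabilisers.

  module Homogeneous (M : Structure L) (uh : Ultrahomogeneous M) where

    -- Ultrahomogeneity speaks of induced substructures; the isomorphism fed to it runs from the
    -- image of `i` back to `S` and on to the image of `e`.
    homogeneous : {S : Structure L} → Finite S → (i e : Embedding S M) →
      Σ[ α ∈ M ≅ M ] (∀ s → α · emb i s ≡ emb e s)
    homogeneous {S} fin i e
      with α , eqs ← uh (Image {L = L} (emb i)) (Image {L = L} (emb e))
             (finite-≅ (≅-image i) fin) (finite-≅ (≅-image e) fin) (≅-image i ⁻¹ ⨾ ≅-image e)
      = α , λ s → trans (eqs (≅-image i · s)) (cong (emb e) (inverseˡ (≅-image i) s))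

    homogeneous-on : {S : Structure L} (i e : Embedding S M) (xs : List (Carrier S)) →
      Σ[ α ∈ M ≅ M ] (∀ {s} → s ∈ₗ xs → α · emb i s ≡ emb e s)
    homogeneous-on {S} i e xs
      with α , eqs ← homogeneous (finite-list S xs)
             (inclusion S (_∈ₗ xs) ⨾ₑ i) (inclusion S (_∈ₗ xs) ⨾ₑ e)
      = α , λ {s} s∈ → eqs (s , [ s∈ ])

    agree-on : (e : Embedding M M) (xs : List (Carrier M)) →
      Σ[ α ∈ M ≅ M ] (∀ {x} → x ∈ₗ xs → α · x ≡ emb e x)
    agree-on = homogeneous-on (≅⇒embedding ≅-refl)

    Fixes : M ≅ M → List (Carrier M) → Set ℓ
    Fixes α as = ∀ {a} → a ∈ₗ as → α · a ≡ a

    Orbit : List (Carrier M) → Carrier M → Pred (Carrier M) ℓ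
    Orbit as b v = Σ[ γ ∈ M ≅ M ] Fixes γ as × γ · b ≡ v

    -- A copy presented as a self-embedding of `M` with values in `U`: such maps compose, and the
    -- statement stays in `Set ℓ`.
    Hosts : Pred (Carrier M) ℓ → Set ℓ
    Hosts U = Σ[ e ∈ Embedding M M ] (∀ x → emb e x ∈ U)

    hosts⇒contains : {U : Pred (Carrier M) ℓ} → Hosts U → ContainsCopy M U
    hosts⇒contains {U} (e , e∈U) =
      Image {L = L} (emb e) , ≅-image e ⁻¹ , λ { (x , eq) → subst U eq (e∈U x) }

    copy⇒hosts : {N : Pred (Carrier M) ℓ} → IsCopy M N → Hosts N
    copy⇒hosts {N} g = ≅⇒embedding (g ⁻¹) ⨾ₑ inclusion M N , λ x → member (g ⁻¹ · x)

    contains⇒hosts : {U : Pred (Carrier M) ℓ} → ContainsCopy M U → Hosts U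
    contains⇒hosts (N , g , N⊆U) with e , e∈N ← copy⇒hosts g = e , λ x → N⊆U (e∈N x)

    fixed∉orbit : {as : List (Carrier M)} {b a : Carrier M} → b ∉ₗ as → a ∈ₗ as → a ∉ Orbit as b
    fixed∉orbit b∉as a∈ (γ , fix , eq) =
      b∉as (subst (_∈ₗ _) (·-injective γ (trans (fix a∈) (sym eq))) a∈)

    -- Quantifier-free types, open sets and orbits.

    SameType : Pred (Carrier M) ℓ → Carrier M → Carrier M → Set ℓ
    SameType A v b = qftp M A v ≐ qftp M A b

    automorphism⇒same-type : {A : Pred (Carrier M) ℓ} {b v : Carrier M} (γ : M ≅ M) →
      (∀ {a} → a ∈ A → γ · a ≡ a) → γ · b ≡ v → SameType A v b
    automorphism⇒same-type {A} {b} {v} γ fix eq =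
      (λ {φ} → Equivalence.from (transfer φ)) , (λ {φ} → Equivalence.to (transfer φ))
      where
      transfer = ⊨-embedding {ρ = maybe value b} {σ = maybe value v} (≅⇒embedding γ)
        λ { nothing → eq ; (just z) → fix (member z) }

    -- Both maps interpret the same structure on the variables, pulled back along b ∷ A.
    same-type⇒automorphism : {A : Pred (Carrier M) ℓ} {b v : Carrier M} → b ∉ A →
      (as : List (Carrier M)) → (∀ {a} → a ∈ₗ as → a ∈ A) → SameType A v b → v ∈ Orbit as b
    same-type⇒automorphism {A} {b} {v} b∉A as as⊆A (to-b , to-v) =
      let γ , eqs = homogeneous-on i e (nothing ∷ justs as as⊆A) in
      γ , (λ a∈ → eqs (there (justs-complete as as⊆A a∈))) , eqs (here refl)
      where
      Var = Maybe (Refinement (Carrier M) A)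
      Type : Structure L
      Type = record { Carrier = Var ; Rel = λ R xs → Rel M R (map (maybe value b) xs) }
      b-injective : ∀ {x y : Var} → maybe value b x ≡ maybe value b y → x ≡ y
      b-injective {nothing} {nothing} eq = refl
      b-injective {nothing} {just z}  eq = contradiction (subst A (sym eq) (member z)) b∉A
      b-injective {just z}  {nothing} eq = contradiction (subst A eq (member z)) b∉A
      b-injective {just z}  {just w}  eq = cong just (value-injective eq)
      i e : Embedding Type M
      i = record { to = maybe value b ; injective = b-injective ; preserves = λ R xs → mk⇔ id id }
      e = record
        { to        = maybe value v
        ; injective = λ {x} {y} eq → b-injective (to-b {x ≈′ y} eq)
        ; preserves = λ R xs → mk⇔ (to-v {rel R xs}) (to-b {rel R xs})
        }
      justs : (as : List (Carrier M)) → (∀ {a} → a ∈ₗ as → a ∈ A) → List Var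
      justs []       _    = []
      justs (a ∷ as) as⊆A = just (a , [ as⊆A (here refl) ]) ∷ justs as (as⊆A ∘ there)
      justs-complete : (as : List (Carrier M)) (as⊆A : ∀ {a} → a ∈ₗ as → a ∈ A) →
        ∀ {a} (a∈ : a ∈ₗ as) → just (a , [ as⊆A a∈ ]) ∈ₗ justs as as⊆A
      justs-complete (a ∷ as) as⊆A (here refl) = here refl
      justs-complete (a ∷ as) as⊆A (there a∈)  = there (justs-complete as (as⊆A ∘ there) a∈)

    basic-open⇒open : {U : Pred (Carrier M) ℓ} → BasicOpen M U → Open M U
    basic-open⇒open basic x∈U = _ , basic , x∈U , id

    orbit-open : {as : List (Carrier M)} {b : Carrier M} → b ∉ₗ as → Open M (Orbit as b)
    orbit-open {as} {b} b∉as = basic-open⇒open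
      ( (_∈ₗ as) , finite-list M as , b , b∉as
      , (λ (γ , fix , eq) → automorphism⇒same-type γ fix eq)
      , same-type⇒automorphism b∉as as id )

    -- The witness `as` lists the finite parameter set `A` of a basic neighbourhood inside `U`; an
    -- automorphism fixing that list preserves types over `A`.
    open⊇orbit : {U : Pred (Carrier M) ℓ} → Open M U → Satisfiable U →
      ∃[ as ] ∃[ b ] b ∉ₗ as × Orbit as b ⊆ U
    open⊇orbit o (x , x∈U)
      with V , (A , (n , f) , b , b∉A , V⊆ , ⊆V) , x∈V , V⊆U ← o x∈U
      = as , b , b∉A ∘ as⊆A , λ (γ , fix , eq) →
          V⊆U (⊆V (automorphism⇒same-type γ (fix ∘ A⊆as) eq))
      where
      as : List (Carrier M)
      as = List.map (value ∘ Inverse.to f) (allFin n)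
      as⊆A : ∀ {a} → a ∈ₗ as → a ∈ A
      as⊆A a∈ with j , _ , refl ← ∈-map⁻ _ a∈ = member (Inverse.to f j)
      A⊆as : ∀ {a} → a ∈ A → a ∈ₗ as
      A⊆as {a} a∈ = subst (_∈ₗ as) (cong value (Inverse.strictlyInverseˡ f (a , [ a∈ ])))
        (∈-map⁺ (value ∘ Inverse.to f) (∈-allFin (Inverse.from f (a , [ a∈ ]))))

    HostingOrbits : Set ℓ
    HostingOrbits = ∀ {as b} → b ∉ₗ as → Hosts (Orbit as b)

    locally-replicable⇒hosting-orbits : LocallyReplicable M → HostingOrbits
    locally-replicable⇒hosting-orbits lr {b = b} b∉as =
      contains⇒hosts (lr _ (orbit-open b∉as) (b , ≅-refl , (λ _ → refl) , refl))

    hosting-orbits⇒locally-replicable : HostingOrbits → LocallyReplicable M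
    hosting-orbits⇒locally-replicable host U o sat
      with as , b , b∉as , orbit⊆U ← open⊇orbit o sat
      with e , e∈ ← host b∉as = hosts⇒contains (e , λ x → orbit⊆U (e∈ x))

    -- Copies of `M` inside orbits, from the galah property.

    -- `e` itself need not extend to an automorphism of `M`, but by homogeneity its restriction to a
    -- finite list does.
    agree-on-⊆ : {C : Pred (Carrier M) ℓ} (e : Embedding (Induced M C) M) {as : List (Carrier M)}
      (as⊆C : ∀ {a} → a ∈ₗ as → a ∈ C) →
      Σ[ α ∈ M ≅ M ] (∀ {a} (a∈ : a ∈ₗ as) → α · a ≡ emb e (a , [ as⊆C a∈ ]))
    agree-on-⊆ e {as} as⊆C
      with α , eqs ← homogeneous (finite-list M as) (inclusion M _) (induced-mono M as⊆C ⨾ₑ e)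
      = α , λ a∈ → eqs (_ , [ a∈ ])

    -- M realises the image under g of the type of b over as, so the copy realises that type itself.
    orbit-complement-not-copy : ∀ {as b} → b ∉ₗ as → ¬ IsCopy M (_∉ Orbit as b)
    orbit-complement-not-copy {as} {b} b∉as g =
      -- `α` and `β` both follow `g` on `as`, while `α` sends `b` and `β` sends `v` to `c`. So
      -- `α ⨾ β ⁻¹` fixes `as` and carries `b` to `v`, which puts `v` in the orbit that the copy
      -- avoids.
      member (g ⁻¹ · c) (α ⨾ β ⁻¹
        , (λ a∈ → inverse-unique β (trans (β≡ (there a∈)) (sym (α≡ a∈))))
        , inverse-unique β (trans (β≡ (here refl)) (inverseʳ g c)))
      where
      as⊆ : ∀ {a} → a ∈ₗ as → a ∉ Orbit as b
      as⊆ = fixed∉orbit b∉as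
      over-as = agree-on-⊆ (≅⇒embedding g) as⊆
      α = proj₁ over-as
      α≡ : ∀ {a} (a∈ : a ∈ₗ as) → α · a ≡ g · (a , [ as⊆ a∈ ])
      α≡ = proj₂ over-as
      c = α · b
      v = value (g ⁻¹ · c)
      v∷as⊆ : ∀ {a} → a ∈ₗ v ∷ as → a ∉ Orbit as b
      v∷as⊆ (here refl) = member (g ⁻¹ · c)
      v∷as⊆ (there a∈)  = as⊆ a∈
      over-v∷as = agree-on-⊆ (≅⇒embedding g) v∷as⊆
      β = proj₁ over-v∷as
      β≡ : ∀ {a} (a∈ : a ∈ₗ v ∷ as) → β · a ≡ g · (a , [ v∷as⊆ a∈ ])
      β≡ = proj₂ over-v∷as

    galah⇒hosting-orbits : Galah M → HostingOrbits
    galah⇒hosting-orbits galah {as} {b} b∉as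
      with galah (_∉ Orbit as b) (Orbit as b) (λ v → swap (toSum em)) (λ v (v∉ , v∈) → v∉ v∈)
    ... | inj₁ g    = contradiction g (orbit-complement-not-copy b∉as)
    ... | inj₂ copy = contains⇒hosts copy

    -- Strong amalgamation makes orbits infinite.

    module Amalgam {as xs : List (Carrier M)} {b : Carrier M} {C : Structure L} (h : Embedding C M)
      (g₀ : Embedding (Induced M (_∈ₗ b ∷ as)) C) (g₁ : Embedding (Induced M (_∈ₗ as ++ xs)) C)
      (commutes : ∀ {a} (a∈ : a ∈ₗ as) → emb g₀ (a , [ there a∈ ]) ≡ emb g₁ (a , [ ∈-++⁺ˡ a∈ ]))
      (α₀ α₁ : M ≅ M) (α₀≡ : ∀ z → α₀ · value z ≡ emb h (emb g₀ z))
      (α₁≡ : ∀ z → α₁ · value z ≡ emb h (emb g₁ z)) where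

      γ : M ≅ M
      γ = α₀ ⨾ α₁ ⁻¹

      γ-fixes : Fixes γ as
      γ-fixes {a} a∈ = inverse-unique α₁ (trans (α₁≡ (a , [ ∈-++⁺ˡ a∈ ]))
        (trans (cong (emb h) (sym (commutes a∈))) (sym (α₀≡ (a , [ there a∈ ])))))

      meet : (γb∈ : γ · b ∈ₗ xs) →
        emb g₁ (γ · b , [ ∈-++⁺ʳ as γb∈ ]) ≡ emb g₀ (b , [ here refl ])
      meet γb∈ = injective h (trans (sym (α₁≡ (γ · b , [ ∈-++⁺ʳ as γb∈ ])))
        (trans (inverseʳ α₁ (α₀ · b)) (α₀≡ (b , [ here refl ]))))

    -- Amalgamate `b ∷ as` with `as ++ xs` strongly over `as`, and place the amalgam in `M` so that
    -- `as ++ xs` returns to its own position; `b` then lands on a point of its orbit. If that point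
    -- were in `xs`, the two sides would meet at the image of `b`, and strongness would put `b` in
    -- `as`.
    orbit-infinite : StrongAmalgamation M →
      ∀ {as b} → b ∉ₗ as → ∀ xs → ∃[ v ] v ∈ Orbit as b × v ∉ₗ xs
    orbit-infinite sa {as} {b} b∉as xs
      with C , (_ , h) , g₀ , g₁ , commutes , strong , _ ←
        sa (Induced M (_∈ₗ as)) (Induced M (_∈ₗ b ∷ as)) (Induced M (_∈ₗ as ++ xs))
          (finite-list M as , inclusion M _) (finite-list M (b ∷ as) , inclusion M _)
          (finite-list M (as ++ xs) , inclusion M _) (induced-mono M there) (induced-mono M ∈-++⁺ˡ)
      with α₀ , α₀≡ ← homogeneous (finite-list M (b ∷ as)) (inclusion M _) (g₀ ⨾ₑ h)
      with α₁ , α₁≡ ← homogeneous (finite-list M (as ++ xs)) (inclusion M _) (g₁ ⨾ₑ h)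
      = γ · b , (γ , γ-fixes , refl) , λ γb∈ →
          let z , eq = strong ((_ , refl) , (γ · b , [ ∈-++⁺ʳ as γb∈ ]) , meet γb∈)
          in b∉as (subst (_∈ₗ as) (cong value (injective g₀ eq)) (member z))
      where open Amalgam {xs = xs} h g₀ g₁ (λ a∈ → commutes (_ , [ a∈ ])) α₀ α₁ α₀≡ α₁≡

    -- Limits of chains of automorphisms.

    module Chain (l : ℕ → List (Carrier M)) (α : ℕ → M ≅ M)
      (grow : ∀ n {x} → x ∈ₗ l n → x ∈ₗ l (suc n) × α (suc n) · x ≡ α n · x) where

      later′ : ∀ {n n′ x} → n ≤′ n′ → x ∈ₗ l n → x ∈ₗ l n′ × α n′ · x ≡ α n · x
      later′ (≤′-reflexive refl) x∈ = x∈ , refl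
      later′ (≤′-step n≤)        x∈ with x∈′ , eq ← later′ n≤ x∈ with x∈″ , eq′ ← grow _ x∈′ =
        x∈″ , trans eq′ eq

      later : ∀ {n n′ x} → n ≤ n′ → x ∈ₗ l n → x ∈ₗ l n′ × α n′ · x ≡ α n · x
      later = later′ ∘ ℕ.≤⇒≤′

      agree : ∀ {n n′ x} → x ∈ₗ l n → x ∈ₗ l n′ → α n · x ≡ α n′ · x
      agree {n} {n′} x∈ x∈′ with ℕ.≤-total n n′
      ... | inj₁ n≤n′ = sym (proj₂ (later n≤n′ x∈))
      ... | inj₂ n′≤n = proj₂ (later n′≤n x∈′)

      module _ {S : Structure L} (j : Embedding S M)
        (stage : Carrier S → ℕ) (settled : ∀ s → emb j s ∈ₗ l (stage s)) where

        bound : ∀ {n} (ss : Vec (Carrier S) n) → ∃[ N ] VecAll (λ s → stage s ≤ N) ss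
        bound []       = 0 , []ᵛ
        bound (s ∷ ss) with N , ≤N ← bound ss =
          stage s ⊔ N , ℕ.m≤m⊔n _ _ ∷ᵛ VecAll.map (λ p → ℕ.≤-trans p (ℕ.m≤n⊔m _ _)) ≤N

        -- Finitely many points are all settled by a common stage `N`, so on them the limit agrees
        -- with `j` followed by the single automorphism `α N`.
        limit : Embedding S M
        limit = locally-embedding (λ s → α (stage s) · emb j s) λ ss → let N , ≤N = bound ss in
          j ⨾ₑ ≅⇒embedding (α N) , VecAll.map (λ {s} p → proj₂ (later p (settled s))) ≤N

    module Countable (enum : ℕ ↔ Carrier M) where

      nth : ℕ → Carrier M
      nth = Inverse.to enum

      position : Carrier M → ℕ
      position = Inverse.from enum

      nth-position : ∀ x → nth (position x) ≡ x
      nth-position = Inverse.strictlyInverseˡ enum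

      position-injective : ∀ {x y} → position x ≡ position y → x ≡ y
      position-injective {x} {y} eq = trans (sym (nth-position x)) (trans (cong nth eq) (nth-position y))

      nth-injective : ∀ {m n} → nth m ≡ nth n → m ≡ n
      nth-injective {m} {n} eq = trans (sym (Inverse.strictlyInverseʳ enum m))
        (trans (cong position eq) (Inverse.strictlyInverseʳ enum n))

      -- Back-and-forth between a subset and `M`.

      module BackAndForth (C : Pred (Carrier M) ℓ)
        (dense : ∀ {as b} → (∀ {a} → a ∈ₗ as → a ∈ C) → b ∉ₗ as → ∃[ v ] v ∈ Orbit as b × v ∈ C) where

        -- A finite partial isomorphism from `C` to `M`, represented by its domain and an
        -- automorphism extending it; only the values on the domain persist.
        State : Set ℓ
        State = Σ[ as ∈ List (Carrier M) ] (∀ {a} → a ∈ₗ as → a ∈ C) × M ≅ M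

        dom : State → List (Carrier M)
        dom = proj₁

        aut : State → M ≅ M
        aut = proj₂ ∘ proj₂

        record Extends (s t : State) : Set ℓ where
          field
            dom-⊆     : ∀ {a} → a ∈ₗ dom s → a ∈ₗ dom t
            aut-agree : ∀ {a} → a ∈ₗ dom s → aut t · a ≡ aut s · a
        open Extends

        -- As the partial map already extends to the automorphism `α`, enlarging the domain leaves
        -- `α` unchanged; points outside `C` are skipped.
        forth : (m : Carrier M) (s : State) → Σ[ t ∈ State ] Extends s t × (m ∈ C → m ∈ₗ dom t)
        forth m s@(as , as⊆C , α) with em {m ∈ C}
        ... | no  m∉C = s , record { dom-⊆ = id ; aut-agree = λ _ → refl } , λ m∈C → contradiction m∈C m∉C
        ... | yes m∈C = (m ∷ as , (λ { (here refl) → m∈C ; (there a∈) → as⊆C a∈ }) , α)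
          , record { dom-⊆ = there ; aut-agree = λ _ → refl } , λ _ → here refl

        back : (m : Carrier M) (s : State) →
          Σ[ t ∈ State ] Extends s t × (∃[ x ] x ∈ₗ dom t × aut t · x ≡ m)
        back m s@(as , as⊆C , α) with em {α ⁻¹ · m ∈ₗ as}
        ... | yes b∈as = s , record { dom-⊆ = id ; aut-agree = λ _ → refl } , _ , b∈as , inverseʳ α m
        -- The preimage of `m` under `α` may lie outside `C`. Density moves it by some `γ` fixing
        -- `as` to a point `v` of `C`; then `γ ⁻¹ ⨾ α` sends `v` to `m` and keeps the values on
        -- `as`.
        ... | no  b∉as with v , (γ , fix , refl) , v∈C ← dense as⊆C b∉as
          = (v ∷ as , (λ { (here refl) → v∈C ; (there a∈) → as⊆C a∈ }) , γ ⁻¹ ⨾ α)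
          , record { dom-⊆ = there ; aut-agree = λ a∈ → cong (α ·_) (inverse-unique γ (fix a∈)) }
          , v , here refl , trans (cong (α ·_) (inverseˡ γ _)) (inverseʳ α m)

        step : ℕ → State → State
        step n s = proj₁ (back (nth n) (proj₁ (forth (nth n) s)))

        step-extends : ∀ n s → Extends s (step n s)
        step-extends n s with t , s≤t , _ ← forth (nth n) s with u , t≤u , _ ← back (nth n) t = record
          { dom-⊆     = dom-⊆ t≤u ∘ dom-⊆ s≤t
          ; aut-agree = λ a∈ → trans (aut-agree t≤u (dom-⊆ s≤t a∈)) (aut-agree s≤t a∈)
          }

        step-forth : ∀ n s → nth n ∈ C → nth n ∈ₗ dom (step n s)
        step-forth n s m∈C with t , _ , m∈ ← forth (nth n) s with u , t≤u , _ ← back (nth n) t =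
          dom-⊆ t≤u (m∈ m∈C)

        step-back : ∀ n s → ∃[ x ] x ∈ₗ dom (step n s) × aut (step n s) · x ≡ nth n
        step-back n s = proj₂ (proj₂ (back (nth n) (proj₁ (forth (nth n) s))))

        state : ℕ → State
        state = iterate step ([] , (λ ()) , ≅-refl)

        open Chain (dom ∘ state) (aut ∘ state)
          (λ n a∈ → dom-⊆ (step-extends n (state n)) a∈ , aut-agree (step-extends n (state n)) a∈)

        -- `nth n` is treated in the step from `state n` to `state (suc n)`, hence the `suc`.
        stage : Refinement (Carrier M) C → ℕ
        stage z = suc (position (value z))

        settled : ∀ z → value z ∈ₗ dom (state (stage z))
        settled z = subst (_∈ₗ dom (state (stage z))) (nth-position (value z))
          (step-forth n (state n) (subst C (sym (nth-position (value z))) (member z)))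
          where n = position (value z)

        isomorphism : Induced M C ≅ M
        isomorphism = surjective⇒≅ (limit (inclusion M C) stage settled) λ y →
          let n = position y
              x , x∈ , eq = step-back n (state n)
              z = x , [ proj₁ (proj₂ (state (suc n))) x∈ ]
          -- `x` is in the domain at stage `suc n`, which need not be its own `stage z`; `agree`
          -- shows that both stages give it the same value.
          in z , trans (agree {stage z} {suc n} (settled z) x∈) (trans eq (nth-position y))

      hosting-orbits⇒galah : HostingOrbits → Galah M
      hosting-orbits⇒galah host C D C∪D _
        with em {Σ[ as ∈ List (Carrier M) ] Σ[ b ∈ Carrier M ] (∀ {a} → a ∈ₗ as → a ∈ C) × b ∉ₗ as ×
                 (∀ v → v ∈ Orbit as b → v ∉ C)}
      ... | yes (as , b , _ , b∉as , orbit∩C) with e , e∈ ← host b∉as =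
        inj₂ (hosts⇒contains (e , λ x → inD (C∪D (emb e x)) (orbit∩C _ (e∈ x))))
        where
        inD : ∀ {x} → x ∈ C ⊎ x ∈ D → x ∉ C → x ∈ D
        inD (inj₁ x∈C) x∉C = contradiction x∈C x∉C
        inD (inj₂ x∈D) _   = x∈D
      -- No orbit over a finite part of `C` misses `C`, which is the density that back-and-forth
      -- needs.
      ... | no ¬∃ = inj₁ (BackAndForth.isomorphism C λ as⊆C b∉as → decidable-stable em λ ¬hit →
        ¬∃ (_ , _ , as⊆C , b∉as , λ v v∈ v∈C → ¬hit (v , v∈ , v∈C)))

      -- A copy with increasing colours.

      module Rainbow (χ : Carrier M → ℕ)
        (unbounded : ∀ {as b} → b ∉ₗ as → ∀ n → ∃[ v ] v ∈ Orbit as b × n ≤ χ v) where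

        first : ℕ → List (Carrier M)
        first = applyDownFrom nth

        ∈-first : ∀ {m n} → m < n → nth m ∈ₗ first n
        ∈-first = ∈-applyDownFrom⁺ nth

        nth∉first : ∀ n → nth n ∉ₗ first n
        nth∉first n n∈ with m , m<n , eq ← ∈-applyDownFrom⁻ nth n∈ =
          ℕ.<-irrefl (nth-injective (sym eq)) m<n

        image-of-first : ℕ → M ≅ M → List (Carrier M)
        image-of-first n α = List.map (α ·_) (first n)

        abstract
          -- `unbounded` is applied to the orbit of `α · nth n` over the images of the earlier
          -- points: `γ` fixes those images and moves the new one to a colour above all of theirs.
          extend : ∀ n (α : M ≅ M) → Σ[ β ∈ M ≅ M ] (∀ {x} → x ∈ₗ first n → β · x ≡ α · x) ×
            max 0 (List.map χ (image-of-first n α)) < χ (β · nth n)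
          extend n α
            with v , (γ , fix , refl) , χ> ← unbounded {image-of-first n α} {α · nth n}
              (λ n∈ → let x , x∈ , eq = ∈-map⁻ (α ·_) n∈ in
                nth∉first n (subst (_∈ₗ first n) (sym (·-injective α eq)) x∈))
              (suc (max 0 (List.map χ (image-of-first n α))))
            = α ⨾ γ , (λ x∈ → fix (∈-map⁺ (α ·_) x∈)) , χ>

        α : ℕ → M ≅ M
        α = iterate (λ n → proj₁ ∘ extend n) ≅-refl

        grow : ∀ n {x} → x ∈ₗ first n → x ∈ₗ first (suc n) × α (suc n) · x ≡ α n · x
        grow n x∈ with m , m<n , refl ← ∈-applyDownFrom⁻ nth x∈ =
          ∈-first (ℕ.m<n⇒m<1+n m<n) , proj₁ (proj₂ (extend n (α n))) x∈

        open Chain first α grow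

        stage : Carrier M → ℕ
        stage x = suc (position x)

        settled : ∀ x → x ∈ₗ first (stage x)
        settled x = subst (_∈ₗ first (stage x)) (nth-position x) (∈-first ℕ.≤-refl)

        rainbow : Embedding M M
        rainbow = limit (≅⇒embedding ≅-refl) stage settled

        -- The image of `x` is final by stage `position y`, so its colour is among those that the
        -- choice made for `y` exceeds.
        increasing : ∀ {x y} → position x < position y → χ (emb rainbow x) < χ (emb rainbow y)
        increasing {x} {y} x<y = begin-strict
          χ (α (stage x) · x)                            ≡⟨ cong χ (sym αx≡) ⟩
          χ (α n · x)                                    ≤⟨ All.lookup (xs≤max 0 _) (∈-map⁺ χ (∈-map⁺ (α n ·_) x∈)) ⟩
          max 0 (List.map χ (image-of-first n (α n)))    <⟨ proj₂ (proj₂ (extend n (α n))) ⟩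
          χ (α (suc n) · nth n)                          ≡⟨ cong (λ z → χ (α (suc n) · z)) (nth-position y) ⟩
          χ (α (stage y) · y)                            ∎
          where
          open ℕ.≤-Reasoning
          n = position y
          x∈ : x ∈ₗ first n
          x∈ = proj₁ (later x<y (settled x))
          αx≡ : α n · x ≡ α (stage x) · x
          αx≡ = proj₂ (later x<y (settled x))

        heterochromatic : Heterochromatic M χ (Image {L = L} (emb rainbow))
        heterochromatic (x , refl) (y , refl) x≢y eq with ℕ.<-cmp (position x) (position y)
        ... | tri< x<y _ _ = ℕ.<-irrefl eq (increasing x<y)
        ... | tri≈ _ x≡y _ = x≢y (cong (emb rainbow) (position-injective x≡y))
        ... | tri> _ _ y<x = ℕ.<-irrefl (sym eq) (increasing y<x)

      -- Canonical colourings from the galah property.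

      -- Induction on the number of colours. When a copy avoids the top colour, the colouring is
      -- pulled back along its embedding, so that it again colours all of `M`.
      galah⇒monochromatic : Galah M → ∀ n (χ : Carrier M → ℕ) → (∀ x → χ x < n) →
        Σ[ e ∈ Embedding M M ] (∀ x y → χ (emb e x) ≡ χ (emb e y))
      galah⇒monochromatic galah zero    χ χ<0 = contradiction (χ<0 (nth 0)) λ ()
      galah⇒monochromatic galah (suc n) χ χ≤n
        with galah (λ x → Lift ℓ (χ x ≡ n)) (λ x → Lift ℓ (χ x ≢ n))
          (λ x → Sum.map lift lift (toSum (χ x ℕ.≟ n))) (λ x (eq , ≢n) → lower ≢n (lower eq))
      ... | inj₁ g with e , e≡n ← copy⇒hosts g = e , λ x y → trans (lower (e≡n x)) (sym (lower (e≡n y)))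
      ... | inj₂ copy with e , e≢n ← contains⇒hosts copy
        with f , const ← galah⇒monochromatic galah n (χ ∘ emb e)
          (λ x → ℕ.≤∧≢⇒< (ℕ.≤-pred (χ≤n (emb e x))) (lower (e≢n x))) = f ⨾ₑ e , const

      galah⇒canonical : Galah M → CanonicalPointRamsey M
      galah⇒canonical galah χ
        with em {Σ[ as ∈ List (Carrier M) ] Σ[ b ∈ Carrier M ] b ∉ₗ as ×
                 ∃[ n ] (∀ {v} → v ∈ Orbit as b → χ v < n)}
      ... | yes (as , b , b∉as , n , bounded)
        with e , e∈ ← galah⇒hosting-orbits galah b∉as
        with f , const ← galah⇒monochromatic galah n (χ ∘ emb e) (λ x → bounded (e∈ x))
        = Image {L = L} (emb (f ⨾ₑ e)) , ≅-image (f ⨾ₑ e) ⁻¹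
        , inj₁ λ { (x , refl) (y , refl) → const x y }
      ... | no ¬∃ = Image {L = L} (emb rainbow) , ≅-image rainbow ⁻¹ , inj₂ heterochromatic
        where
        unbounded : ∀ {as b} → b ∉ₗ as → ∀ n → ∃[ v ] v ∈ Orbit as b × n ≤ χ v
        unbounded {as} {b} b∉as n = decidable-stable em λ ¬hit →
          ¬∃ (as , b , b∉as , n , λ v∈ → ℕ.≰⇒> λ n≤ → ¬hit (_ , v∈ , n≤))
        open Rainbow χ unbounded

      -- Copies of `M` inside orbits, from canonical colourings.

      -- Colour v by the least code of a tuple t with (t , v) in the orbit of (as , b), shifted by one;
      -- colour 0 means that there is no such tuple.
      module OrbitColouring (as : List (Carrier M)) (b : Carrier M) where

        tuple-code : M ≅ M → ℕ
        tuple-code γ = code (List.map (position ∘ (γ ·_)) as)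

        tuple-code-injective : ∀ {γ δ} → tuple-code γ ≡ tuple-code δ →
          ∀ {a} → a ∈ₗ as → γ · a ≡ δ · a
        tuple-code-injective eq a∈ = position-injective (map-≡⇒≡ (code-injective _ _ eq) a∈)

        -- Tuples enter only as images of `as` under automorphisms, so a single `γ` witnesses both
        -- the tuple and the type of `v` over it.
        Over : ℕ → Pred (Carrier M) ℓ
        Over i v = Σ[ γ ∈ M ≅ M ] tuple-code γ ≡ i × γ · b ≡ v

        -- The decision is an argument so that the lemmas about `χ` can split on it.
        colour : ∀ v → Dec (∃[ i ] v ∈ Over i) → ℕ
        colour v (yes (i , v∈)) = suc (proj₁ (least {λ i → v ∈ Over i} v∈))
        colour v (no _)         = 0

        χ : Carrier M → ℕ
        χ v = colour v em

        over⇒coloured : ∀ {i v} → v ∈ Over i → ∃[ j ] χ v ≡ suc j × j ≤ i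
        over⇒coloured {i} {v} v∈ with em {∃[ i ] v ∈ Over i}
        ... | yes (_ , w) = _ , refl , proj₂ (proj₂ (least {λ i → v ∈ Over i} w)) v∈
        ... | no ¬∃       = contradiction (i , v∈) ¬∃

        coloured⇒over : ∀ {j v} → χ v ≡ suc j → v ∈ Over j
        coloured⇒over {j} {v} eq with em {∃[ i ] v ∈ Over i}
        ... | yes (_ , w) = subst (λ i → v ∈ Over i) (ℕ.suc-injective eq)
          (proj₁ (proj₂ (least {λ i → v ∈ Over i} w)))
        coloured⇒over {j} {v} () | no _

        monochromatic⇒hosts : (e : Embedding M M) → (∀ x → χ (emb e x) ≡ χ (emb e b)) →
          Hosts (Orbit as b)
        monochromatic⇒hosts e mono
          -- `α` agrees with `e` at `b`, so `emb e b` lies over the image of `as` under `α`, and the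
          -- common colour is not 0.
          with α , α≡ ← agree-on e (b ∷ [])
          with j , χ≡ , _ ← over⇒coloured (α , refl , α≡ (here refl))
          with γ₀ , code≡ , _ ← coloured⇒over χ≡
          -- All values of `e` lie over the one tuple to which `γ₀` carries `as`; composing with
          -- `γ₀ ⁻¹` brings that tuple back to `as`.
          = e ⨾ₑ ≅⇒embedding (γ₀ ⁻¹) , λ x →
              let γ , code≡′ , γb≡ = coloured⇒over (trans (mono x) χ≡)
              in γ ⨾ γ₀ ⁻¹
                , (λ a∈ → inverse-unique γ₀ (sym (tuple-code-injective {γ} {γ₀} (trans code≡′ (sym code≡)) a∈)))
                , cong (γ₀ ⁻¹ ·_) γb≡

        -- On the orbit of b the embedding e takes boundedly many colours: each of its values
        -- lies over the image of as.
        ¬heterochromatic : (∀ xs → ∃[ v ] v ∈ Orbit as b × v ∉ₗ xs) → (e : Embedding M M) →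
          ¬ (∀ {x y} → χ (emb e x) ≡ χ (emb e y) → x ≡ y)
        ¬heterochromatic infinite e hetero
          with xs , complete ← injective-bounded⇒finite (Orbit as b) (χ ∘ emb e) (λ _ _ → hetero)
                 -- The colours in question are `suc j` with `j` at most this code, and the bound is
                 -- strict: hence two successors.
                 (suc (suc (code (List.map (position ∘ emb e) as))))
          with v , v∈@(γ , fix , γb≡v) , v∉xs ← infinite xs
          with α , α≡ ← agree-on e (v ∷ as)
          -- `γ ⨾ α` sends `as` where `e` does and `b` to `emb e v`, so `emb e v` lies over the
          -- image of `as` under `e`.
          with j , χ≡ , j≤ ← over⇒coloured {v = emb e v} (γ ⨾ α
            , cong code (map-cong-∈ λ a∈ → cong position (trans (cong (α ·_) (fix a∈)) (α≡ (there a∈))))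
            , trans (cong (α ·_) γb≡v) (α≡ (here refl)))
          = v∉xs (complete v∈ (subst (_< _) (sym χ≡) (s≤s (s≤s j≤))))

      canonical⇒hosting-orbits : StrongAmalgamation M → CanonicalPointRamsey M → HostingOrbits
      canonical⇒hosting-orbits sa canonical {as} {b} b∉as with canonical (OrbitColouring.χ as b)
      ... | N , g , inj₁ mono with e , e∈ ← copy⇒hosts g =
        OrbitColouring.monochromatic⇒hosts as b e λ x → mono (e∈ x) (e∈ b)
      ... | N , g , inj₂ hetero with e , e∈ ← copy⇒hosts g =
        ⊥-elim (OrbitColouring.¬heterochromatic as b (orbit-infinite sa b∉as) e
          λ eq → decidable-stable em λ x≢y → hetero (e∈ _) (e∈ _) (x≢y ∘ injective e) eq)

proposition2p15 : ∀ {ℓ : Level} → ExcludedMiddle ℓ →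
    (L : Language ℓ) (M : Structure L) →
    IsFraisse M → StrongAmalgamation M →
    (CanonicalPointRamsey M ⇔ Galah M) × (Galah M ⇔ LocallyReplicable M)
proposition2p15 em L M (enum , uh) sa =
  mk⇔ (hosting-orbits⇒galah ∘ canonical⇒hosting-orbits sa) galah⇒canonical ,
  mk⇔ (hosting-orbits⇒locally-replicable ∘ galah⇒hosting-orbits)
      (hosting-orbits⇒galah ∘ locally-replicable⇒hosting-orbits)
  where
  open Classical em
  open Homogeneous M uh
  open Countable enum
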